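{- Let $n=T_{k+1}-2$ for some integer $k\geq 1$, where $T_i=\binom{i+1}{2}$. Then $|\mathcal{M}^*_n|=1$, and the unique maximum weight jump-float sequence of length $n$ is the perfect sequence for $n$, $$p =(1,0,\underbrace{3,3}_{2},0,\underbrace{6,6,6}_{3},0,\underbrace{10,10,10,10}_{4},0,\ldots,0,\underbrace{T_k,\ldots,T_k}_{k}),$$ with weight $w_n^* = \sum_{i=1}^k i\,T_i$.
   Context: A jump-float sequence of length $n$ is an integer sequence $s=(s_1,\ldots,s_n)$ with $0\le s_i\le i$ for $1\le i\le n$ and such that, for $2\le i\le n$, if $s_i>s_{i-1}$ then $s_{i-1}=0$. Its weight is $w(s)=\sum_{i=1}^n s_i$. $w_n^*$ is the maximum weight over all jump-float sequences of length $n$, and $\mathcal{M}^*_n$ is the set of jump-float sequences of length $n$ with weight $w_n^*$. The perfect sequence for $n=T_{k+1}-2$ is the concatenation, for $i=1,\dots,k$ in order, of $i$ copies of $T_i$, with a single $0$ between consecutive such runs. -}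

module Defs where

open import Data.Fin.Base using (Fin; toℕ)
open import Data.List.Base using (List; []; _∷_; [_]; _∷ʳ_; _++_; length; replicate; applyUpTo; intercalate)
open import Data.List.Properties using (applyUpTo-∷ʳ; length-++; length-replicate)
open import Data.Nat.Base using (ℕ; zero; suc; _+_; _∸_; _≤_; _<_)
open import Data.Nat.Combinatorics using (_C_; nC1≡n; nCk+nC[k+1]≡[n+1]C[k+1])
open import Data.Nat.Properties using (+-comm)
open import Data.Product.Base using (_×_; ∃-syntax)
open import Data.Refinement.Base using (Refinement)
open import Data.Vec.Base as Vec using (Vec; lookup; fromList; cast)
open import Function.Bundles using (_↔_)
open import Level using (0ℓ)
open import Relation.Binary.PropositionalEquality using (_≡_; refl; sym; trans; cong; module ≡-Reasoning)
open import Relation.Unary using (Pred)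

T : ℕ → ℕ
T i = suc i C 2

-- Entries lie in ℕ, which is the condition 0 ≤ sᵢ on integers.  The
-- entry sᵢ (1 ≤ i ≤ n) is lookup s j for the j : Fin n with toℕ j = i - 1.
record IsJumpFloat {n : ℕ} (s : Vec ℕ n) : Set where
  field
    bounded : ∀ (i : Fin n) → lookup s i ≤ suc (toℕ i)
    jump    : ∀ (i j : Fin n) → toℕ j ≡ suc (toℕ i) →
              lookup s i < lookup s j → lookup s i ≡ 0

weight : ∀ {n} → Vec ℕ n → ℕ
weight = Vec.sum

-- w*ₙ is specified as a maximum: IsMaxWeight n w says w = w*ₙ.
IsMaxWeight : ℕ → ℕ → Set
IsMaxWeight n w =
  (∃[ s ] IsJumpFloat {n} s × weight s ≡ w) ×
  (∀ (s : Vec ℕ n) → IsJumpFloat s → weight s ≤ w)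

𝓜* : (n : ℕ) → Pred (Vec ℕ n) 0ℓ
𝓜* n s = IsJumpFloat s × IsMaxWeight n (weight s)

-- Refinement makes the membership proof irrelevant, so that elements of
-- the subset are counted, and not proofs that they belong to it.
∣_∣≡_ : {A : Set} → Pred A 0ℓ → ℕ → Set
∣_∣≡_ {A} P m = Refinement A P ↔ Fin m

run : ℕ → List ℕ
run i = replicate i (T i)

-- applyUpTo f k is f 0 , … , f (k - 1), hence the shift by suc.
perfectList : ℕ → List ℕ
perfectList k = intercalate [ 0 ] (applyUpTo (λ i → run (suc i)) k)

length-intercalate-∷ʳ : ∀ (x : ℕ) ys yss zs →
  length (intercalate [ x ] ((ys ∷ yss) ∷ʳ zs)) ≡
  suc (length zs) + length (intercalate [ x ] (ys ∷ yss))
length-intercalate-∷ʳ x ys [] zs =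
  trans (length-++ ys) (+-comm (length ys) _)
length-intercalate-∷ʳ x ys (ws ∷ yss) zs = begin
  length (ys ++ x ∷ intercalate [ x ] ((ws ∷ yss) ∷ʳ zs))
    ≡⟨ length-++ ys ⟩
  length ys + suc (length (intercalate [ x ] ((ws ∷ yss) ∷ʳ zs)))
    ≡⟨ cong (λ m → length ys + suc m) (length-intercalate-∷ʳ x ws yss zs) ⟩
  length ys + suc (a + b)
    ≡⟨ +-rearrange (length ys) a b ⟩
  a + (length ys + suc b)
    ≡⟨ cong (a +_) (length-++ ys) ⟨
  a + length (intercalate [ x ] (ys ∷ ws ∷ yss)) ∎
  where
  open ≡-Reasoning
  open import Data.Nat.Solver using (module +-*-Solver)
  open +-*-Solver
  a = suc (length zs)
  b = length (intercalate [ x ] (ws ∷ yss))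
  +-rearrange : ∀ y a b → y + suc (a + b) ≡ a + (y + suc b)
  +-rearrange = solve 3 (λ y a b →
    y :+ (con 1 :+ (a :+ b)) := a :+ (y :+ (con 1 :+ b))) refl

T-suc : ∀ i → T (suc i) ≡ suc i + T i
T-suc i = trans (sym (nCk+nC[k+1]≡[n+1]C[k+1] (suc i) 1))
                (cong (_+ T i) (nC1≡n (suc i)))

2+length-perfectList : ∀ k → 2 + length (perfectList (suc k)) ≡ T (suc (suc k))
2+length-perfectList zero    = refl
2+length-perfectList (suc k) = begin
  2 + length (perfectList (suc (suc k)))
    ≡⟨ cong (λ l → 2 + length (intercalate [ 0 ] l))
            (applyUpTo-∷ʳ (λ i → run (suc i)) (suc k)) ⟨
  2 + length (intercalate [ 0 ] (applyUpTo (λ i → run (suc i)) (suc k) ∷ʳ run (suc (suc k))))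
    ≡⟨ cong (2 +_) (length-intercalate-∷ʳ 0 (run 1) (applyUpTo (λ i → run (suc (suc i))) k) (run (suc (suc k)))) ⟩
  2 + (suc (length (run (suc (suc k)))) + length (perfectList (suc k)))
    ≡⟨ cong (λ m → 2 + (suc m + length (perfectList (suc k)))) (length-replicate (suc (suc k))) ⟩
  2 + (suc (suc (suc k)) + length (perfectList (suc k)))
    ≡⟨ swap (suc (suc (suc k))) (length (perfectList (suc k))) ⟩
  suc (suc (suc k)) + (2 + length (perfectList (suc k)))
    ≡⟨ cong (suc (suc (suc k)) +_) (2+length-perfectList k) ⟩
  suc (suc (suc k)) + T (suc (suc k))
    ≡⟨ T-suc (suc (suc k)) ⟨
  T (suc (suc (suc k))) ∎
  where
  open ≡-Reasoning
  open import Data.Nat.Solver using (module +-*-Solver)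
  open +-*-Solver
  swap : ∀ a b → 2 + (a + b) ≡ a + (2 + b)
  swap = solve 2 (λ a b → con 2 :+ (a :+ b) := a :+ (con 2 :+ b)) refl

length-perfectList : ∀ k → length (perfectList k) ≡ T (suc k) ∸ 2
length-perfectList zero    = refl
length-perfectList (suc k) = cong (_∸ 2) (2+length-perfectList k)

perfect : ∀ k → Vec ℕ (T (suc k) ∸ 2)
perfect k = cast (length-perfectList k) (fromList (perfectList k))

{-# OPTIONS --safe #-}

-- Prepend an entry 0, so that a jump-float sequence of length n becomes a
-- concatenation of N = n + 1 entries in blocks, each made of a 0 followed
-- by e positive entries.  If N' entries precede the block, then those e
-- entries are at most N' + 1.  Let c₀ = 0 and
-- cₖ₊₁ = cₖ + (k + 2)² - 2.  Induction on the number of blocks gives, for the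
-- weight w and every k,
--   2 w + 2 k N ≤ N² + cₖ,
-- because appending a block with e positive entries and passing from k to
-- k + 1 raises the right side minus the left side by at least
-- (e - (k + 1))².  For k = 0 equality holds only for N = 0.  For k + 1
-- equality forces the last block to have e = k + 1 entries, all equal to
-- N' + 1, and equality for k on the preceding blocks; so the perfect sequence
-- is the only one to attain the bound, and it has N = T (k + 1) - 1.
module Submission where

open import Defs
open import Data.Empty using (⊥-elim)
open import Data.Fin.Base as Fin using (Fin; toℕ)
open import Data.List.Base
  using (List; []; _∷_; [_]; _++_; length; replicate; reverse; map; intercalate; applyUpTo; _ʳ++_)
open import Data.List.Properties
  using (length-++; length-reverse; reverse-injective; map-applyUpTo; applyUpTo-∷ʳ;
         ∷-injectiveʳ; ++-identityʳ)
open import Data.List.Relation.Binary.Permutation.Propositional.Properties using (↭-reverse)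
open import Data.List.Relation.Unary.All as All using (All; []; _∷_)
open import Data.Nat.Base using (ℕ; zero; suc; _+_; _*_; _∸_; _≤_; _<_; _≥_; z≤n; z<s)
open import Data.Nat.ListAction using (sum)
open import Data.Nat.ListAction.Properties using (sum-++; sum-↭)
open import Data.Nat.Properties
open import Data.Nat.Tactic.RingSolver using (solve-∀)
open import Data.Product.Base using (_×_; _,_; proj₁; proj₂)
open import Data.Refinement using (value-injective; _,_)
open import Data.Irrelevant using () renaming ([_] to irr)
open import Data.Sum.Base using (inj₁; inj₂)
open import Data.Vec.Base as Vec using (Vec; []; _∷_; lookup; toList; fromList; cast)
import Data.Vec.Properties as Vec
open import Function.Base using (_∘_)
open import Function.Bundles using (mk↔ₛ′)
open import Relation.Binary.PropositionalEquality
  using (_≡_; refl; sym; trans; cong; cong₂; subst; module ≡-Reasoning)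
open import Relation.Nullary.Decidable.Core using (recompute; yes; no)
open import Relation.Nullary.Negation.Core using (contradiction)
open import Relation.Unary using (_∈_)

-- Elementary inequalities and their equality cases

-- A strict inequality in either summand would make the sum strict. This carries equality in the
-- bound over to each of its terms.
+-tight : ∀ {a b c d} → a ≤ c → b ≤ d → c + d ≤ a + b → a ≡ c × b ≡ d
+-tight {a} {b} {c} {d} a≤c b≤d c+d≤a+b =
  ≤-antisym a≤c (+-cancelʳ-≤ d c a (≤-trans c+d≤a+b (+-monoʳ-≤ a b≤d))) ,
  ≤-antisym b≤d (+-cancelˡ-≤ c d b (≤-trans c+d≤a+b (+-monoˡ-≤ b a≤c)))

-- This is m² + b² - 2 m b = (b - m)² with b = m + n. The square `n * n` is the slack of the
-- inequality below and vanishes in its equality case.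
[m+n]²-expand : ∀ m n → m * m + (m + n) * (m + n) ≡ 2 * (m * (m + n)) + n * n
[m+n]²-expand = solve-∀

2mn≤m²+n² : ∀ m n → 2 * (m * n) ≤ m * m + n * n
2mn≤m²+n² m n with ≤-total m n
... | inj₁ m≤n with o , refl ← m≤n⇒∃[o]m+o≡n m≤n =
  subst (2 * (m * n) ≤_) (sym ([m+n]²-expand m o)) (m≤m+n _ (o * o))
... | inj₂ n≤m with o , refl ← m≤n⇒∃[o]m+o≡n n≤m
  rewrite *-comm (n + o) n | +-comm ((n + o) * (n + o)) (n * n) =
  subst (2 * (n * (n + o)) ≤_) (sym ([m+n]²-expand n o)) (m≤m+n _ (o * o))

m+n²≤m⇒n≡0 : ∀ m n → m + n * n ≤ m → n ≡ 0
m+n²≤m⇒n≡0 m zero    _ = refl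
m+n²≤m⇒n≡0 m (suc n) p = ⊥-elim (m+1+n≰m m p)

2mn≡m²+n²⇒m≡n : ∀ m n → 2 * (m * n) ≡ m * m + n * n → m ≡ n
2mn≡m²+n²⇒m≡n m n eq with ≤-total m n
... | inj₁ m≤n with o , refl ← m≤n⇒∃[o]m+o≡n m≤n
  rewrite m+n²≤m⇒n≡0 _ o (≤-reflexive (sym (trans eq ([m+n]²-expand m o)))) =
  sym (+-identityʳ m)
... | inj₂ n≤m with o , refl ← m≤n⇒∃[o]m+o≡n n≤m
  rewrite *-comm (n + o) n | +-comm ((n + o) * (n + o)) (n * n)
        | m+n²≤m⇒n≡0 _ o (≤-reflexive (sym (trans eq ([m+n]²-expand n o)))) =
  +-identityʳ n

-- Sums of lists

sum-replicate : ∀ n m → sum (replicate n m) ≡ n * m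
sum-replicate zero    m = refl
sum-replicate (suc n) m = cong (m +_) (sum-replicate n m)

sum-bounded : ∀ {m r} → All (_≤ m) r → sum r ≤ length r * m
sum-bounded []       = z≤n
sum-bounded (p ∷ ps) = +-mono-≤ p (sum-bounded ps)

sum-bounded-tight : ∀ {m r} → All (_≤ m) r → sum r ≡ length r * m →
                    r ≡ replicate (length r) m
sum-bounded-tight []       _  = refl
sum-bounded-tight (p ∷ ps) eq with +-tight p (sum-bounded ps) (≤-reflexive (sym eq))
... | x≡m , rest = cong₂ _∷_ x≡m (sum-bounded-tight ps rest)

sum-reverse : ∀ l → sum (reverse l) ≡ sum l
sum-reverse l = sum-↭ (↭-reverse l)

sum-toList : ∀ {n} (s : Vec ℕ n) → sum (toList s) ≡ weight s
sum-toList []      = refl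
sum-toList (x ∷ s) = cong (x +_) (sum-toList s)

sum-intercalate-0 : ∀ xss → sum (intercalate [ 0 ] xss) ≡ sum (map sum xss)
sum-intercalate-0 []              = refl
sum-intercalate-0 (xs ∷ [])       = sym (+-identityʳ (sum xs))
sum-intercalate-0 (xs ∷ ys ∷ xss) = trans
  (sum-++ xs (0 ∷ intercalate [ 0 ] (ys ∷ xss)))
  (cong (sum xs +_) (sum-intercalate-0 (ys ∷ xss)))

-- The quadratic bound for blocks and its equality case

-- Lists are reversed here: the head of the list is the last entry.
data Blocks : List ℕ → Set where
  []    : Blocks []
  block : ∀ {r l} → All (λ x → 0 < x × x ≤ suc (length l)) r → Blocks l →
          Blocks (r ++ 0 ∷ l)

-- For k ≥ 1 this is the perfect sequence with 0 prepended, reversed: the length is T (k + 1) - 1,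
-- so the run added next has value T (k + 1).
extremal : ℕ → List ℕ
extremal zero    = []
extremal (suc k) = replicate (suc k) (suc (length (extremal k))) ++ 0 ∷ extremal k

-- The constant cₖ, with (k + 2)² - 2 expanded to avoid the subtraction.
offset : ℕ → ℕ
offset zero    = 0
offset (suc k) = offset k + (k * k + 4 * k + 2)

lhs rhs : ℕ → List ℕ → ℕ
lhs k l = 2 * sum l + 2 * k * length l
rhs k l = length l * length l + offset k

private
  common : ℕ → ℕ → ℕ → ℕ
  common k e N = 2 * e * N + 2 * e + 2 * N + 2 * suc k

length-block : ∀ (r : List ℕ) l → length (r ++ 0 ∷ l) ≡ length r + suc (length l)
length-block r l = length-++ r

-- With 2 e (N + 1) added, both sides split without subtraction into summands
-- that compare termwise: sum r ≤ e (N + 1), then 2 e (k + 1) ≤ e² + (k + 1)²,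
-- which is (e - (k + 1))² ≥ 0, and the bound for l.
lhs-block : ∀ k r l → let e = length r ; N = length l in
  lhs (suc k) (r ++ 0 ∷ l) + 2 * (e * suc N) ≡
  common k e N + (2 * sum r + (2 * (e * suc k) + lhs k l))
lhs-block k r l rewrite sum-++ r (0 ∷ l) | length-block r l =
  identity k (length r) (length l) (sum r) (sum l)
  where
  identity : ∀ k e N R L →
    2 * (R + L) + 2 * suc k * (e + suc N) + 2 * (e * suc N) ≡
    2 * e * N + 2 * e + 2 * N + 2 * suc k + (2 * R + (2 * (e * suc k) + (2 * L + 2 * k * N)))
  identity = solve-∀

rhs-block : ∀ k r l → let e = length r ; N = length l in
  rhs (suc k) (r ++ 0 ∷ l) + 2 * (e * suc N) ≡
  common k e N + (2 * (e * suc N) + ((e * e + suc k * suc k) + rhs k l))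
rhs-block k r l rewrite length-block r l =
  identity k (length r) (length l) (offset k)
  where
  identity : ∀ k e N O →
    (e + suc N) * (e + suc N) + (O + (k * k + 4 * k + 2)) + 2 * (e * suc N) ≡
    2 * e * N + 2 * e + 2 * N + 2 * suc k + (2 * (e * suc N) + ((e * e + suc k * suc k) + (N * N + O)))
  identity = solve-∀

-- The gap is at least e² + 2 N + 1, which is positive even for an empty run.
lhs<rhs-block-0 : ∀ {r l} → All (_≤ suc (length l)) r → lhs 0 l ≤ rhs 0 l →
                  lhs 0 (r ++ 0 ∷ l) < rhs 0 (r ++ 0 ∷ l)
lhs<rhs-block-0 {r} {l} ps le
  rewrite sum-++ r (0 ∷ l) | length-block r l = begin-strict
  2 * (sum r + sum l) + 0
    ≡⟨ regroup (sum r) (sum l) ⟩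
  2 * sum r + (2 * sum l + 0)
    ≤⟨ +-mono-≤ (*-monoʳ-≤ 2 (sum-bounded ps)) le ⟩
  2 * (e * suc N) + (N * N + 0)
    <⟨ m<m+n _ z<s ⟩
  2 * (e * suc N) + (N * N + 0) + suc (e * e + 2 * N)
    ≡⟨ square e N ⟩
  (e + suc N) * (e + suc N) + 0 ∎
  where
  open ≤-Reasoning
  e = length r
  N = length l
  regroup : ∀ R L → 2 * (R + L) + 0 ≡ 2 * R + (2 * L + 0)
  regroup = solve-∀
  square : ∀ e N → 2 * (e * suc N) + (N * N + 0) + suc (e * e + 2 * N) ≡
                   (e + suc N) * (e + suc N) + 0
  square = solve-∀

lhs≤rhs : ∀ {l} k → Blocks l → lhs k l ≤ rhs k l
lhs≤rhs k       [] rewrite *-zeroʳ (2 * k) = z≤n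
lhs≤rhs zero    (block ps bs) = <⇒≤ (lhs<rhs-block-0 (All.map proj₂ ps) (lhs≤rhs 0 bs))
lhs≤rhs (suc k) (block {r} {l} ps bs) = +-cancelʳ-≤ (2 * (e * suc N)) _ _ (begin
  lhs (suc k) (r ++ 0 ∷ l) + 2 * (e * suc N)
    ≡⟨ lhs-block k r l ⟩
  common k e N + (2 * sum r + (2 * (e * suc k) + lhs k l))
    ≤⟨ +-monoʳ-≤ (common k e N)
         (+-mono-≤ (*-monoʳ-≤ 2 (sum-bounded (All.map proj₂ ps)))
           (+-mono-≤ (2mn≤m²+n² e (suc k)) (lhs≤rhs k bs))) ⟩
  common k e N + (2 * (e * suc N) + ((e * e + suc k * suc k) + rhs k l))
    ≡⟨ rhs-block k r l ⟨
  rhs (suc k) (r ++ 0 ∷ l) + 2 * (e * suc N) ∎)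
  where
  open ≤-Reasoning
  e = length r
  N = length l

tight⇒extremal : ∀ {l} k → Blocks l → rhs k l ≤ lhs k l → l ≡ extremal k
tight⇒extremal zero    []            _  = refl
tight⇒extremal zero    (block ps bs) le =
  ⊥-elim (<⇒≱ (lhs<rhs-block-0 (All.map proj₂ ps) (lhs≤rhs 0 bs)) le)
-- The left side is 0 and the right side is `offset (suc k)`, at least 2; the rewrites expose its
-- successor.
tight⇒extremal (suc k) []            le
  rewrite *-zeroʳ (2 * suc k) | +-suc (k * k + 4 * k) 1 | +-suc (offset k) (k * k + 4 * k + 1)
  with () ← le
tight⇒extremal (suc k) (block {r} {l} ps bs) le = begin
  r ++ 0 ∷ l
    ≡⟨ cong (_++ 0 ∷ l) (sum-bounded-tight ps′ (*-cancelˡ-≡ _ _ 2 sum≡)) ⟩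
  replicate (length r) (suc (length l)) ++ 0 ∷ l
    ≡⟨ cong (λ e → replicate e (suc (length l)) ++ 0 ∷ l) (2mn≡m²+n²⇒m≡n _ _ len≡) ⟩
  replicate (suc k) (suc (length l)) ++ 0 ∷ l
    ≡⟨ cong (λ l → replicate (suc k) (suc (length l)) ++ 0 ∷ l)
         (tight⇒extremal k bs (≤-reflexive (sym rest≡))) ⟩
  extremal (suc k) ∎
  where
  open ≡-Reasoning
  e = length r
  N = length l
  ps′ = All.map proj₂ ps
  A₁ = *-monoʳ-≤ 2 (sum-bounded ps′)
  A₂ = 2mn≤m²+n² e (suc k)
  A₃ = lhs≤rhs k bs
  -- The assumption `le` in split form, with the shared summand cancelled.
  total : 2 * (e * suc N) + ((e * e + suc k * suc k) + rhs k l) ≤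
          2 * sum r + (2 * (e * suc k) + lhs k l)
  total = +-cancelˡ-≤ (common k e N) _ _
    (≤-trans (≤-reflexive (sym (rhs-block k r l)))
      (≤-trans (+-monoˡ-≤ (2 * (e * suc N)) le) (≤-reflexive (lhs-block k r l))))
  -- Splitting twice yields three equalities: for the sum of `r`, for e = k + 1, and for `l` at k.
  split₁ = +-tight A₁ (+-mono-≤ A₂ A₃) total
  sum≡ = proj₁ split₁
  split₂ = +-tight A₂ A₃ (≤-reflexive (sym (proj₂ split₁)))
  len≡ = proj₁ split₂
  rest≡ = proj₂ split₂

-- From jump-float sequences to blocks

-- Steps i x l: the entries l may follow an entry x at position i, in the
-- numbering for which the prepended 0 has position 0.
data Steps (i x : ℕ) : List ℕ → Set where
  []   : Steps i x []
  step : ∀ {y l} → y ≤ suc i → (x < y → x ≡ 0) → Steps (suc i) y l → Steps i x (y ∷ l)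

-- The jump condition enters here. A zero opens a new block. A positive entry after 0 starts a run
-- under its position bound; after a positive x it is at most x and inherits the bound of x. The
-- equation `l ≡ x ∷ t` lets the blocks be split although `r ++ 0 ∷ l` does not unify with `x ∷ t`.
blocks-∷ : ∀ {l x t y} → Blocks l → l ≡ x ∷ t → y ≤ length l → (x < y → x ≡ 0) → Blocks (y ∷ l)
blocks-∷ {y = zero}  bs                  _    _  _    = block [] bs
blocks-∷ {y = suc y} (block [] bs)       refl y≤ _    = block ((z<s , y≤) ∷ []) bs
blocks-∷ {x = x} {y = suc y} (block (p ∷ ps) bs) refl _ jump with suc y ≤? x
... | yes y≤x = block ((z<s , ≤-trans y≤x (proj₂ p)) ∷ p ∷ ps) bs
... | no  y≰x = contradiction (sym (jump (≰⇒> y≰x))) (<⇒≢ (proj₁ p))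

-- The accumulator `x ∷ t` holds positions 0 to i, so its length is the bound on the next entry.
steps⇒blocks : ∀ {i x l t} → Steps i x l → length (x ∷ t) ≡ suc i → Blocks (x ∷ t) →
               Blocks (l ʳ++ x ∷ t)
steps⇒blocks []             _  bs = bs
steps⇒blocks (step y≤ jump ss) eq bs =
  steps⇒blocks ss (cong suc eq) (blocks-∷ bs refl (≤-trans y≤ (≤-reflexive (sym eq))) jump)

Jumps : ∀ {n} → Vec ℕ n → Set
Jumps {n} s = ∀ (i j : Fin n) → toℕ j ≡ suc (toℕ i) → lookup s i < lookup s j → lookup s i ≡ 0

steps-toList : ∀ {n} i x (s : Vec ℕ n) → (∀ j → lookup s j ≤ suc (i + toℕ j)) →
               Jumps (x ∷ s) → Steps i x (toList s)
steps-toList i x []      _     _     = []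
steps-toList i x (y ∷ s) bound jumps = step
  (subst (λ m → y ≤ suc m) (+-identityʳ i) (bound Fin.zero))
  (jumps Fin.zero (Fin.suc Fin.zero) refl)
  (steps-toList (suc i) y s
    (λ j → subst (λ m → lookup s j ≤ suc m) (+-suc i (toℕ j)) (bound (Fin.suc j)))
    (λ p q eq → jumps (Fin.suc p) (Fin.suc q) (cong suc eq)))

steps⇒bounded : ∀ {n} i x (s : Vec ℕ n) → Steps i x (toList s) → ∀ j → lookup s j ≤ suc (i + toℕ j)
steps⇒bounded i x (y ∷ s) (step y≤ _ _)  Fin.zero    =
  subst (λ m → y ≤ suc m) (sym (+-identityʳ i)) y≤
steps⇒bounded i x (y ∷ s) (step _ _ ss) (Fin.suc j) =
  subst (λ m → lookup s j ≤ suc m) (sym (+-suc i (toℕ j))) (steps⇒bounded (suc i) y s ss j)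

steps⇒jumps : ∀ {n} i x (s : Vec ℕ n) → Steps i x (toList s) → Jumps (x ∷ s)
steps⇒jumps i x (y ∷ s) (step _ jump _) Fin.zero    (Fin.suc Fin.zero) _  = jump
steps⇒jumps i x (y ∷ s) (step _ _ ss)   (Fin.suc p) (Fin.suc q)        eq =
  steps⇒jumps (suc i) y s ss p q (suc-injective eq)

isJumpFloat⇒steps : ∀ {n} {s : Vec ℕ n} → IsJumpFloat s → Steps 0 0 (toList s)
isJumpFloat⇒steps {n} {s} jf = steps-toList 0 0 s bounded jumps
  where
  open IsJumpFloat jf
  jumps : Jumps (0 ∷ s)
  -- A jump from the prepended entry is always allowed, as that entry is 0.
  jumps Fin.zero    _           _  _ = refl
  jumps (Fin.suc p) (Fin.suc q) eq   = jump p q (suc-injective eq)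

steps⇒isJumpFloat : ∀ {n} {s : Vec ℕ n} → Steps 0 0 (toList s) → IsJumpFloat s
steps⇒isJumpFloat {s = s} ss = record
  { bounded = steps⇒bounded 0 0 s ss
  ; jump    = λ i j eq → steps⇒jumps 0 0 s ss (Fin.suc i) (Fin.suc j) (cong suc eq)
  }

module _ {n : ℕ} (s : Vec ℕ n) where

  0∷-reversed : List ℕ
  0∷-reversed = reverse (0 ∷ toList s)

  blocks-0∷-reversed : IsJumpFloat s → Blocks 0∷-reversed
  blocks-0∷-reversed jf = steps⇒blocks (isJumpFloat⇒steps jf) refl (block [] [])

  sum-0∷-reversed : sum 0∷-reversed ≡ weight s
  sum-0∷-reversed = trans (sum-reverse (0 ∷ toList s)) (sum-toList s)

  length-0∷-reversed : length 0∷-reversed ≡ suc n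
  length-0∷-reversed = trans (length-reverse (0 ∷ toList s)) (cong suc (Vec.length-toList s))

  lhs-0∷-reversed : ∀ k → lhs k 0∷-reversed ≡ 2 * weight s + 2 * k * suc n
  lhs-0∷-reversed k rewrite sum-0∷-reversed | length-0∷-reversed = refl

  rhs-0∷-reversed : ∀ k → rhs k 0∷-reversed ≡ suc n * suc n + offset k
  rhs-0∷-reversed k rewrite length-0∷-reversed = refl

-- The perfect sequence is jump-float

-- The rest is assumed to be allowed after any entry because it follows x when n = 0 and v
-- otherwise.
steps-replicate : ∀ {i x l} n v → (x < v → x ≡ 0) → v ≤ suc i →
                  (∀ y → Steps (n + i) y l) → Steps i x (replicate n v ++ l)
steps-replicate zero v _ _ ss = ss _
steps-replicate {i} {l = l} (suc n) v jump v≤ ss = step v≤ jump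
  (steps-replicate n v (λ v<v → contradiction v<v (<-irrefl refl)) (m≤n⇒m≤1+n v≤)
    (λ y → subst (λ j → Steps j y l) (sym (+-suc n i)) (ss y)))

-- Generality in `f` and `m` follows `applyUpTo`, which recurses on `f ∘ suc`. By the invariant
-- `suc i ≡ T m` the run of value T m starts at position T m, so its first entry meets its bound
-- exactly.
steps-intercalate : ∀ {f : ℕ → List ℕ} {i} k m → (∀ j → f j ≡ run (j + m)) → suc i ≡ T m →
                    Steps i 0 (intercalate [ 0 ] (applyUpTo f k))
steps-intercalate zero m _ _ = []
steps-intercalate {f} {i} (suc zero) m f≡ eq =
  subst (Steps i 0) (trans (++-identityʳ (run m)) (sym (f≡ 0)))
    (steps-replicate m (T m) (λ _ → refl) (≤-reflexive (sym eq)) (λ _ → []))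
steps-intercalate {f} {i} (suc (suc k)) m f≡ eq =
  subst (λ r → Steps i 0 (r ++ 0 ∷ rest)) (sym (f≡ 0))
    (steps-replicate m (T m) (λ _ → refl) (≤-reflexive (sym eq))
      (λ _ → step z≤n (λ ()) (steps-intercalate (suc k) (suc m) f∘suc≡ eq′)))
  where
  open ≡-Reasoning
  rest = intercalate [ 0 ] (applyUpTo (f ∘ suc) (suc k))
  f∘suc≡ : ∀ j → f (suc j) ≡ run (j + suc m)
  f∘suc≡ j = trans (f≡ (suc j)) (cong run (sym (+-suc j m)))
  eq′ : suc (suc (m + i)) ≡ T (suc m)
  eq′ = begin
    suc (suc (m + i)) ≡⟨ cong suc (+-suc m i) ⟨
    suc m + suc i     ≡⟨ cong (suc m +_) eq ⟩
    suc m + T m       ≡⟨ T-suc m ⟨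
    T (suc m)         ∎

steps-perfectList : ∀ k → Steps 0 0 (perfectList k)
steps-perfectList k = steps-intercalate k 1 (λ j → cong run (+-comm 1 j)) refl

toList-cast : ∀ {A : Set} {m n} .(eq : m ≡ n) (xs : Vec A m) → toList (cast eq xs) ≡ toList xs
toList-cast {n = zero}  eq []       = refl
toList-cast {n = suc n} eq (x ∷ xs) = cong (x ∷_) (toList-cast (suc-injective eq) xs)

toList-perfect : ∀ k → toList (perfect k) ≡ perfectList k
toList-perfect k = trans (toList-cast (length-perfectList k) (fromList (perfectList k)))
                         (Vec.toList∘fromList (perfectList k))

perfect-isJumpFloat : ∀ k → IsJumpFloat (perfect k)
perfect-isJumpFloat k = steps⇒isJumpFloat (subst (Steps 0 0) (sym (toList-perfect k)) (steps-perfectList k))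

-- Weight of the perfect sequence

perfectWeight : ℕ → ℕ
perfectWeight k = sum (applyUpTo (λ i → suc i * T (suc i)) k)

perfectWeight-suc : ∀ k → perfectWeight (suc k) ≡ perfectWeight k + suc k * T (suc k)
perfectWeight-suc k = begin
  sum (applyUpTo g (suc k))          ≡⟨ cong sum (applyUpTo-∷ʳ g k) ⟨
  sum (applyUpTo g k ++ [ g k ])     ≡⟨ sum-++ (applyUpTo g k) [ g k ] ⟩
  perfectWeight k + (g k + 0)        ≡⟨ cong (perfectWeight k +_) (+-identityʳ (g k)) ⟩
  perfectWeight k + g k              ∎
  where
  open ≡-Reasoning
  g : ℕ → ℕ
  g i = suc i * T (suc i)

sum-applyUpTo-cong : ∀ {f g : ℕ → ℕ} → (∀ i → f i ≡ g i) → ∀ k → sum (applyUpTo f k) ≡ sum (applyUpTo g k)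
sum-applyUpTo-cong eq zero    = refl
sum-applyUpTo-cong eq (suc k) = cong₂ _+_ (eq 0) (sum-applyUpTo-cong (eq ∘ suc) k)

weight-perfect : ∀ k → weight (perfect k) ≡ perfectWeight k
weight-perfect k = begin
  weight (perfect k)                           ≡⟨ sum-toList (perfect k) ⟨
  sum (toList (perfect k))                     ≡⟨ cong sum (toList-perfect k) ⟩
  sum (perfectList k)                          ≡⟨ sum-intercalate-0 runs ⟩
  sum (map sum runs)                           ≡⟨ cong sum (map-applyUpTo (λ i → run (suc i)) sum k) ⟩
  sum (applyUpTo (λ i → sum (run (suc i))) k)
    ≡⟨ sum-applyUpTo-cong (λ i → sum-replicate (suc i) (T (suc i))) k ⟩
  perfectWeight k                              ∎
  where
  open ≡-Reasoning
  runs = applyUpTo (λ i → run (suc i)) k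

-- By induction: from k to k + 1 both sides increase by `growth`.
perfectWeight-tight : ∀ k {N} → suc N ≡ T (suc k) →
                      2 * perfectWeight k + 2 * k * N ≡ N * N + offset k
perfectWeight-tight zero    {zero} refl = refl
perfectWeight-tight (suc k) {N}    eq = begin
  2 * perfectWeight (suc k) + 2 * suc k * N
    ≡⟨ cong₂ (λ w n → 2 * w + 2 * suc k * n)
         (trans (perfectWeight-suc k) (cong (λ t → W + suc k * t) (T-suc k))) N≡ ⟩
  2 * (W + suc k * suc M) + 2 * suc k * (suc k + suc M)
    ≡⟨ left k M W ⟩
  (2 * W + 2 * k * M) + growth
    ≡⟨ cong (_+ growth) (perfectWeight-tight k (sym (T-suc k))) ⟩
  (M * M + offset k) + growth
    ≡⟨ right k M (offset k) ⟨
  (suc k + suc M) * (suc k + suc M) + offset (suc k)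
    ≡⟨ cong (λ n → n * n + offset (suc k)) N≡ ⟨
  N * N + offset (suc k) ∎
  where
  open ≡-Reasoning
  W = perfectWeight k
  -- The value of N for k, since T (k + 1) = M + 1.
  M = k + T k
  growth = 2 * (k * k) + 2 * (k * M) + 8 * k + 4 * M + 6
  N≡ : N ≡ suc k + suc M
  N≡ = suc-injective (trans eq (trans (T-suc (suc k)) (cong (suc (suc k) +_) (T-suc k))))
  left : ∀ k M W → 2 * (W + suc k * suc M) + 2 * suc k * (suc k + suc M) ≡
                   (2 * W + 2 * k * M) + (2 * (k * k) + 2 * (k * M) + 8 * k + 4 * M + 6)
  left = solve-∀
  right : ∀ k M O → (suc k + suc M) * (suc k + suc M) + (O + (k * k + 4 * k + 2)) ≡
                    (M * M + O) + (2 * (k * k) + 2 * (k * M) + 8 * k + 4 * M + 6)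
  right = solve-∀

-- The maximum weight and uniqueness

-- For k ≥ 1 the truncated subtraction is exact; at k = 0 it would not be, as T 1 = 1.
2+[T[1+k]∸2]≡T[1+k] : ∀ k → k ≥ 1 → 2 + (T (suc k) ∸ 2) ≡ T (suc k)
2+[T[1+k]∸2]≡T[1+k] (suc k) _ =
  trans (cong (2 +_) (sym (length-perfectList (suc k)))) (2+length-perfectList k)

module _ (k : ℕ) (k≥1 : k ≥ 1) where

  private
    n = T (suc k) ∸ 2

  perfect-lhs≡rhs : 2 * perfectWeight k + 2 * k * suc n ≡ suc n * suc n + offset k
  perfect-lhs≡rhs = perfectWeight-tight k (2+[T[1+k]∸2]≡T[1+k] k k≥1)

  weight≤perfectWeight : ∀ (s : Vec ℕ n) → IsJumpFloat s → weight s ≤ perfectWeight k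
  weight≤perfectWeight s jf = *-cancelˡ-≤ 2 (+-cancelʳ-≤ (2 * k * suc n) _ _ (begin
    2 * weight s + 2 * k * suc n         ≡⟨ lhs-0∷-reversed s k ⟨
    lhs k (0∷-reversed s)                ≤⟨ lhs≤rhs k (blocks-0∷-reversed s jf) ⟩
    rhs k (0∷-reversed s)                ≡⟨ rhs-0∷-reversed s k ⟩
    suc n * suc n + offset k             ≡⟨ perfect-lhs≡rhs ⟨
    2 * perfectWeight k + 2 * k * suc n  ∎))
    where open ≤-Reasoning

  0∷-reversed≡extremal : ∀ (s : Vec ℕ n) → IsJumpFloat s → weight s ≡ perfectWeight k →
                         0∷-reversed s ≡ extremal k
  0∷-reversed≡extremal s jf eq = tight⇒extremal k (blocks-0∷-reversed s jf) (≤-reflexive (begin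
    rhs k (0∷-reversed s)                ≡⟨ rhs-0∷-reversed s k ⟩
    suc n * suc n + offset k             ≡⟨ perfect-lhs≡rhs ⟨
    2 * perfectWeight k + 2 * k * suc n  ≡⟨ cong (λ w → 2 * w + 2 * k * suc n) eq ⟨
    2 * weight s + 2 * k * suc n         ≡⟨ lhs-0∷-reversed s k ⟨
    lhs k (0∷-reversed s)                ∎))
    where open ≡-Reasoning

  -- `perfect k` attains the bound as well, so both sequences reverse to `extremal k`, and reversal
  -- is injective.
  weight≡perfectWeight⇒≡perfect : ∀ (s : Vec ℕ n) → IsJumpFloat s → weight s ≡ perfectWeight k →
                                  s ≡ perfect k
  weight≡perfectWeight⇒≡perfect s jf eq =
    trans (sym (Vec.cast-is-id refl s)) (Vec.toList-injective refl s (perfect k)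
      (∷-injectiveʳ (reverse-injective (trans (0∷-reversed≡extremal s jf eq)
        (sym (0∷-reversed≡extremal (perfect k) (perfect-isJumpFloat k) (weight-perfect k)))))))

  isMaxWeight-perfectWeight : IsMaxWeight n (perfectWeight k)
  isMaxWeight-perfectWeight = (perfect k , perfect-isJumpFloat k , weight-perfect k) , weight≤perfectWeight

  perfect∈𝓜* : perfect k ∈ 𝓜* n
  perfect∈𝓜* = perfect-isJumpFloat k ,
    subst (IsMaxWeight n) (sym (weight-perfect k)) isMaxWeight-perfectWeight

  𝓜*-unique : ∀ (s : Vec ℕ n) → s ∈ 𝓜* n → s ≡ perfect k
  𝓜*-unique s (jf , _ , max) = weight≡perfectWeight⇒≡perfect s jf (≤-antisym
    (weight≤perfectWeight s jf)
    (subst (_≤ weight s) (weight-perfect k) (max (perfect k) (perfect-isJumpFloat k))))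

  ∣𝓜*∣≡1 : ∣ 𝓜* n ∣≡ 1
  ∣𝓜*∣≡1 = mk↔ₛ′ (λ _ → Fin.zero) (λ _ → perfect k , irr perfect∈𝓜*)
    (λ { Fin.zero → refl ; (Fin.suc ()) }) (λ { (s , irr s∈) → value-injective (sym
      -- The membership proof is irrelevant, so the equality is recovered by deciding equality of
      -- vectors.
      (recompute (Vec.≡-dec _≟_ s (perfect k)) (𝓜*-unique s s∈))) })

theorem2p14 : ∀ (k : ℕ) → k ≥ 1 →
    let n = T (suc k) ∸ 2 in
    (∣ 𝓜* n ∣≡ 1) ×
    (perfect k ∈ 𝓜* n) ×
    (∀ (s : Vec ℕ n) → s ∈ 𝓜* n → s ≡ perfect k) ×
    IsMaxWeight n (sum (applyUpTo (λ i → suc i * T (suc i)) k))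
theorem2p14 k k≥1 =
  ∣𝓜*∣≡1 k k≥1 , perfect∈𝓜* k k≥1 , 𝓜*-unique k k≥1 , isMaxWeight-perfectWeight k k≥1
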